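{- For $r\in\mathbb{Z}_{\geq 0}$ let $$\alpha(r)=\prod_{j\geq 1}(1+2^{ -j})^{ -1}\prod_{j=1}^{r}\frac{2}{2^j-1}.$$ For $n\in\mathbb{Z}_{\geq 1}$, let $m\in\{0,1\}$ be such that $m\equiv n+1\pmod 2$, and let $$\beta_n=\sum_{r\geq 0}\frac{\alpha(2r+m)}{2^{n+2r+m}-1}.$$ Then $\beta_1=1/2$, and for all $n\in\mathbb{Z}_{\geq 2}$ we have $$\beta_n=2^{ -n}\cdot\left(1-(2^{n-1}-1)\beta_{n-1}\right).$$ -}

module Defs where

open import Data.Nat.Base as ℕ using (ℕ; zero; suc)
import Data.Nat.Properties as ℕP
open import Data.Nat.DivMod using (_%_)
import Data.Integer.Base as ℤ
import Data.Integer.Properties as ℤP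
open import Data.Rational.Base as ℚ using (ℚ; 0ℚ; 1ℚ; ½; 1/_; *≤*; *<*)
import Data.Rational.Properties as ℚP
open import Data.Rational.Solver using (module +-*-Solver)
open import Algebra.Definitions.RawSemiring ℚ.+-*-rawSemiring public using (_^_)
open import Data.Product using (∃-syntax; _×_; _,_; proj₁; proj₂)
open import Data.Sum using (_⊎_; inj₁; inj₂)
open import Relation.Nullary using (contradiction)
open import Relation.Binary.PropositionalEquality
  using (_≡_; refl; sym; trans; cong; cong₂; subst; subst₂)

2ℚ : ℚ
2ℚ = ℤ.+ 2 ℚ./ 1

-- The empty product is 1 and the index starts at 1:  ∏₁ f r = f 1 * ⋯ * f r.
∏₁ : ((j : ℕ) → .{{ℕ.NonZero j}} → ℚ) → ℕ → ℚ
∏₁ f zero    = 1ℚ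
∏₁ f (suc r) = ∏₁ f r ℚ.* f (suc r)

module RationalLemmas where
  open import Data.Rational.Base
  open import Data.Rational.Properties
  open +-*-Solver

  abstract
    dist-triangle : ∀ p q r → ∣ p - r ∣ ≤ ∣ p - q ∣ + ∣ q - r ∣
    dist-triangle p q r = subst (λ t → ∣ t ∣ ≤ ∣ p - q ∣ + ∣ q - r ∣)
      (solve 3 (λ p q r → (p :- q) :+ (q :- r) := p :- r) refl p q r)
      (∣p+q∣≤∣p∣+∣q∣ (p - q) (q - r))

    dist-sym : ∀ p q → ∣ p - q ∣ ≡ ∣ q - p ∣
    dist-sym p q = trans
      (cong ∣_∣ (solve 2 (λ p q → p :- q := :- (q :- p)) refl p q))
      (∣-p∣≡∣p∣ (q - p))

    dist-refl : ∀ p → ∣ p - p ∣ ≡ 0ℚ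
    dist-refl p = cong ∣_∣ (+-inverseʳ p)

    dist-+ : ∀ a b c d → ∣ (a + b) - (c + d) ∣ ≤ ∣ a - c ∣ + ∣ b - d ∣
    dist-+ a b c d = subst (λ t → ∣ t ∣ ≤ ∣ a - c ∣ + ∣ b - d ∣)
      (solve 4 (λ a b c d → (a :- c) :+ (b :- d) := (a :+ b) :- (c :+ d)) refl a b c d)
      (∣p+q∣≤∣p∣+∣q∣ (a - c) (b - d))

    dist-neg : ∀ a c → ∣ (- a) - (- c) ∣ ≡ ∣ a - c ∣
    dist-neg a c = trans
      (cong ∣_∣ (solve 2 (λ a c → (:- a) :- (:- c) := :- (a :- c)) refl a c))
      (∣-p∣≡∣p∣ (a - c))

    dist-* : ∀ a b c d → ∣ a * b - c * d ∣ ≤ ∣ a ∣ * ∣ b - d ∣ + ∣ d ∣ * ∣ a - c ∣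
    dist-* a b c d = subst₂ (λ s t → ∣ s ∣ ≤ t)
      (solve 4 (λ a b c d → a :* (b :- d) :+ d :* (a :- c) := a :* b :- c :* d) refl a b c d)
      (cong₂ _+_ (∣p*q∣≡∣p∣*∣q∣ a (b - d)) (∣p*q∣≡∣p∣*∣q∣ d (a - c)))
      (∣p+q∣≤∣p∣+∣q∣ (a * (b - d)) (d * (a - c)))

    p-q≤r : ∀ {p q r} → p ≤ r + q → p - q ≤ r
    p-q≤r {p} {q} {r} h = subst (p - q ≤_)
      (solve 2 (λ q r → (r :+ q) :- q := r) refl q r) (+-monoˡ-≤ (- q) h)

    ∣a∣-∣c∣≤ : ∀ a c → ∣ a ∣ - ∣ c ∣ ≤ ∣ a - c ∣
    ∣a∣-∣c∣≤ a c = p-q≤r (subst (λ t → ∣ t ∣ ≤ ∣ a - c ∣ + ∣ c ∣)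
      (solve 2 (λ a c → (a :- c) :+ c := a) refl a c) (∣p+q∣≤∣p∣+∣q∣ (a - c) c))

    dist-abs : ∀ a c → ∣ ∣ a ∣ - ∣ c ∣ ∣ ≤ ∣ a - c ∣
    dist-abs a c with ∣p∣≡p∨∣p∣≡-p (∣ a ∣ - ∣ c ∣)
    ... | inj₁ e = subst (_≤ ∣ a - c ∣) (sym e) (∣a∣-∣c∣≤ a c)
    ... | inj₂ e = subst₂ _≤_
      (trans (solve 2 (λ x y → y :- x := :- (x :- y)) refl ∣ a ∣ ∣ c ∣) (sym e))
      (dist-sym c a) (∣a∣-∣c∣≤ c a)

    0<½ : 0ℚ < ½
    0<½ = positive⁻¹ ½

    ½-pos : ∀ {ε} → 0ℚ < ε → 0ℚ < ½ * ε
    ½-pos {ε} h = subst (_< ½ * ε) (*-zeroʳ ½) (*-monoʳ-<-pos ½ h)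

    ½+½ : ∀ ε → ½ * ε + ½ * ε ≡ ε
    ½+½ ε = solve 1 (λ ε → con ½ :* ε :+ con ½ :* ε := ε) refl ε

    split-< : ∀ a b {ε} → a < ½ * ε → b < ½ * ε → a + b < ε
    split-< a b {ε} p q = subst (a + b <_) (½+½ ε) (+-mono-< p q)

    *-mono-≤-nonNeg : ∀ {a b c d} → 0ℚ ≤ c → 0ℚ ≤ b → a ≤ b → c ≤ d → a * c ≤ b * d
    *-mono-≤-nonNeg {a} {b} {c} {d} 0≤c 0≤b p q = ≤-trans
      (*-monoʳ-≤-nonNeg c {{nonNegative 0≤c}} p)
      (*-monoˡ-≤-nonNeg b {{nonNegative 0≤b}} q)

    *-nonNeg : ∀ {a b} → 0ℚ ≤ a → 0ℚ ≤ b → 0ℚ ≤ a * b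
    *-nonNeg {a} {b} p q = nonNegative⁻¹ (a * b)
      {{nonNeg*nonNeg⇒nonNeg a {{nonNegative p}} b {{nonNegative q}}}}

    *-pos : ∀ {a b} → 0ℚ < a → 0ℚ < b → 0ℚ < a * b
    *-pos {a} {b} p q = positive⁻¹ (a * b)
      {{pos*pos⇒pos a {{positive p}} b {{positive q}}}}

    1/-pos : ∀ {p} (h : 0ℚ < p) → 0ℚ < (1/ p) {{>-nonZero h}}
    1/-pos {p} h = positive⁻¹ _ {{1/pos⇒pos p {{positive h}}}}

    p≤p+q : ∀ {p q} → 0ℚ ≤ q → p ≤ p + q
    p≤p+q {p} {q} h = subst (_≤ p + q) (+-identityʳ p) (+-monoʳ-≤ p h)

    q≤p+q : ∀ {p q} → 0ℚ ≤ p → q ≤ p + q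
    q≤p+q {p} {q} h = subst (_≤ p + q) (+-identityˡ q) (+-monoˡ-≤ q h)

    p+δ≤q⇒p<q : ∀ {p q δ} → 0ℚ < δ → p + δ ≤ q → p < q
    p+δ≤q⇒p<q {p} {q} {δ} h k = <-≤-trans
      (subst (_< p + δ) (+-identityʳ p) (+-monoʳ-< p h)) k

    1/-≤ : ∀ {p q} (h : 0ℚ < p) → 1ℚ ≤ p * q → (1/ p) {{>-nonZero h}} ≤ q
    1/-≤ {p} {q} h k = *-cancelˡ-≤-pos p {{positive h}}
      (subst (_≤ p * q) (sym (*-inverseʳ p {{>-nonZero h}})) k)

    0<1 : 0ℚ < 1ℚ
    0<1 = positive⁻¹ 1ℚ

    2^-step : ∀ k → 2ℚ ^ suc k ≡ 2ℚ ^ k + 2ℚ ^ k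
    2^-step k = solve 1 (λ t → con 2ℚ :* t := t :+ t) refl (2ℚ ^ k)

    1≤2^ : ∀ k → 1ℚ ≤ 2ℚ ^ k
    1≤2^ zero    = ≤-refl
    1≤2^ (suc k) = subst (1ℚ ≤_) (sym (2^-step k))
      (≤-trans (1≤2^ k) (p≤p+q (≤-trans (<⇒≤ 0<1) (1≤2^ k))))

    0<2^ : ∀ k → 0ℚ < 2ℚ ^ k
    0<2^ k = <-≤-trans 0<1 (1≤2^ k)

    2^k≤2^[1+k]-1 : ∀ k → 2ℚ ^ k ≤ 2ℚ ^ suc k - 1ℚ
    2^k≤2^[1+k]-1 k = subst₂ _≤_
      (solve 1 (λ t → (t :+ con 1ℚ) :- con 1ℚ := t) refl (2ℚ ^ k))
      (cong (_- 1ℚ) (sym (2^-step k)))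
      (+-monoˡ-≤ (- 1ℚ) (+-monoʳ-≤ (2ℚ ^ k) (1≤2^ k)))

    0<½^ : ∀ k → 0ℚ < ½ ^ k
    0<½^ zero    = 0<1
    0<½^ (suc k) = ½-pos (0<½^ k)

    ½^-step : ∀ k → ½ ^ suc k ≤ ½ ^ k
    ½^-step k = subst (½ ^ suc k ≤_) (½+½ (½ ^ k)) (p≤p+q (<⇒≤ (½-pos (0<½^ k))))

    ½^-anti : ∀ {k l} → k ℕ.≤ l → ½ ^ l ≤ ½ ^ k
    ½^-anti {k} k≤l = go (ℕP.≤⇒≤′ k≤l)
      where
      go : ∀ {l} → k ℕ.≤′ l → ½ ^ l ≤ ½ ^ k
      go (ℕ.≤′-reflexive refl) = ≤-refl
      go (ℕ.≤′-step {l} h)     = ≤-trans (½^-step l) (go h)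

    2^*½^ : ∀ k → 2ℚ ^ k * ½ ^ k ≡ 1ℚ
    2^*½^ zero    = refl
    2^*½^ (suc k) = trans
      (solve 2 (λ s t → (con 2ℚ :* s) :* (con ½ :* t) := s :* t) refl (2ℚ ^ k) (½ ^ k))
      (2^*½^ k)

    0<2^[1+k]-1 : ∀ k → 0ℚ < 2ℚ ^ suc k - 1ℚ
    0<2^[1+k]-1 k = <-≤-trans (0<2^ k) (2^k≤2^[1+k]-1 k)

    1/[2^[1+k]-1]≤½^k : ∀ k → (1/ (2ℚ ^ suc k - 1ℚ)) {{>-nonZero (0<2^[1+k]-1 k)}} ≤ ½ ^ k
    1/[2^[1+k]-1]≤½^k k = 1/-≤ (0<2^[1+k]-1 k)
      (subst (_≤ (2ℚ ^ suc k - 1ℚ) * ½ ^ k) (2^*½^ k)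
        (*-monoʳ-≤-nonNeg (½ ^ k) {{nonNegative (<⇒≤ (0<½^ k))}} (2^k≤2^[1+k]-1 k)))

    fromℕ : ℕ → ℚ
    fromℕ zero    = 0ℚ
    fromℕ (suc k) = fromℕ k + 1ℚ

    0≤fromℕ : ∀ k → 0ℚ ≤ fromℕ k
    0≤fromℕ zero    = ≤-refl
    0≤fromℕ (suc k) = ≤-trans (0≤fromℕ k) (p≤p+q (<⇒≤ 0<1))

    fromℕ-is-/1 : ∀ k → fromℕ k ≡ ℤ.+ k ℚ./ 1
    fromℕ-is-/1 zero    = refl
    fromℕ-is-/1 (suc k) = trans (cong (_+ 1ℚ) (fromℕ-is-/1 k))
      (toℚᵘ-injective (ℚᵘP.≃-trans (toℚᵘ-homo-+ (ℤ.+ k ℚ./ 1) 1ℚ)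
        (ℚᵘP.≃-trans (ℚᵘP.+-congˡ (toℚᵘ 1ℚ) (toℚᵘ-fromℚᵘ (ℚᵘ.mkℚᵘ (ℤ.+ k) 0)))
          (ℚᵘP.≃-trans (ℚᵘ.*≡* (eq k)) (ℚᵘP.≃-sym (toℚᵘ-fromℚᵘ (ℚᵘ.mkℚᵘ (ℤ.+ suc k) 0)))))))
      where
      import Data.Rational.Unnormalised.Base as ℚᵘ
      import Data.Rational.Unnormalised.Properties as ℚᵘP
      eq : ∀ k → (ℤ.+ k ℤ.* ℤ.+ 1 ℤ.+ ℤ.+ 1 ℤ.* ℤ.+ 1) ℤ.* ℤ.+ 1 ≡ ℤ.+ suc k ℤ.* (ℤ.+ 1 ℤ.* ℤ.+ 1)
      eq k = cong (ℤ._* ℤ.+ 1) (trans (cong (ℤ._+ ℤ.+ 1) (ℤP.*-identityʳ (ℤ.+ k))) (cong ℤ.+_ (ℕP.+-comm k 1)))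

    fromℕ<2^ : ∀ k → fromℕ k < 2ℚ ^ k
    fromℕ<2^ zero    = 0<1
    fromℕ<2^ (suc k) = subst (fromℕ (suc k) <_) (sym (2^-step k))
      (+-mono-<-≤ (fromℕ<2^ k) (1≤2^ k))

    fromℕ-upper : ∀ p → ∃[ k ] p ≤ fromℕ k
    fromℕ-upper p@(mkℚ (ℤ.-[1+ _ ]) _ _) = 0 , *≤* ℤ.-≤+
    fromℕ-upper p@(mkℚ (ℤ.+ n) d _) = n , subst (p ≤_) (trans (sym (↥p/↧p≡p (mkℚ (ℤ.+ n) 0 (Coprime-1 n)))) (sym (fromℕ-is-/1 n)))
      (*≤* (ℤP.*-monoˡ-≤-nonNeg (ℤ.+ n) (ℤ.+≤+ (ℕ.s≤s ℕ.z≤n))))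
      where
      open import Data.Nat.Coprimality using (Coprime; 1-coprimeTo) renaming (sym to coprime-sym)
      Coprime-1 : ∀ n → Coprime n 1
      Coprime-1 n = coprime-sym (1-coprimeTo n)

    ½^-small : ∀ c {ε} → 0ℚ < ε → ∃[ N ] c * ½ ^ N < ε
    ½^-small c {ε} 0<ε with fromℕ-upper (c * (1/ ε) {{>-nonZero 0<ε}})
    ... | N , h = N , subst₂ _<_ lhs rhs (*-monoˡ-<-pos (ε * ½ ^ N) {{positive (*-pos 0<ε (0<½^ N))}}
                       (≤-<-trans h (fromℕ<2^ N)))
      where
      instance
        ε≢0 : NonZero ε
        ε≢0 = >-nonZero 0<ε
      lhs : (c * 1/ ε) * (ε * ½ ^ N) ≡ c * ½ ^ N
      lhs = trans (solve 4 (λ c i e t → (c :* i) :* (e :* t) := (i :* e) :* (c :* t)) refl c (1/ ε) ε (½ ^ N))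
        (trans (cong (_* (c * ½ ^ N)) (*-inverseˡ ε)) (*-identityˡ _))
      rhs : 2ℚ ^ N * (ε * ½ ^ N) ≡ ε
      rhs = trans (solve 3 (λ s e t → s :* (e :* t) := (s :* t) :* e) refl (2ℚ ^ N) ε (½ ^ N))
        (trans (cong (_* ε) (2^*½^ N)) (*-identityˡ ε))

    -- N does not depend on x: summing real numbers needs one N for all approximation indices.

    geometric-tail : ∀ c (x : ℕ → ℚ) → (∀ k → ∣ x (suc k) - x k ∣ ≤ c * ½ ^ k) → 0ℚ ≤ c →
                     ∀ d k → ∣ x (d ℕ.+ k) - x k ∣ ≤ (c + c) * ½ ^ k
    geometric-tail c x step 0≤c zero    k = subst (_≤ (c + c) * ½ ^ k) (sym (dist-refl (x k)))
      (*-nonNeg (≤-trans 0≤c (p≤p+q 0≤c)) (<⇒≤ (0<½^ k)))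
    geometric-tail c x step 0≤c (suc d) k = ≤-trans (dist-triangle (x (suc d ℕ.+ k)) (x (suc k)) (x k))
      (subst (∣ x (suc d ℕ.+ k) - x (suc k) ∣ + ∣ x (suc k) - x k ∣ ≤_)
        (solve 2 (λ c t → (c :+ c) :* (con ½ :* t) :+ c :* t := (c :+ c) :* t) refl c (½ ^ k))
        (+-mono-≤ (subst (λ n → ∣ x n - x (suc k) ∣ ≤ (c + c) * ½ ^ suc k) (ℕP.+-suc d k)
                    (geometric-tail c x step 0≤c d (suc k)))
                  (step k)))

    geometric-cauchy : ∀ c → 0ℚ ≤ c → ∀ ε → 0ℚ < ε → ∃[ N ] ∀ (x : ℕ → ℚ) →
      (∀ k → ∣ x (suc k) - x k ∣ ≤ c * ½ ^ k) → ∀ m n → N ℕ.≤ m → N ℕ.≤ n → ∣ x m - x n ∣ < ε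
    geometric-cauchy c 0≤c ε 0<ε = proj₁ small , close
      where
      small : ∃[ N ] (c + c) * ½ ^ N < ½ * ε
      small = ½^-small (c + c) (½-pos 0<ε)
      N : ℕ
      N = proj₁ small
      tail : ∀ (x : ℕ → ℚ) → (∀ k → ∣ x (suc k) - x k ∣ ≤ c * ½ ^ k) →
             ∀ m → N ℕ.≤ m → ∣ x m - x N ∣ < ½ * ε
      tail x step m N≤m = ≤-<-trans
        (subst (λ l → ∣ x l - x N ∣ ≤ (c + c) * ½ ^ N) (ℕP.m∸n+n≡m N≤m)
          (geometric-tail c x step 0≤c (m ℕ.∸ N) N)) (proj₂ small)
      close : ∀ (x : ℕ → ℚ) → (∀ k → ∣ x (suc k) - x k ∣ ≤ c * ½ ^ k) →
              ∀ m n → N ℕ.≤ m → N ℕ.≤ n → ∣ x m - x n ∣ < ε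
      close x step m n N≤m N≤n = ≤-<-trans (dist-triangle (x m) (x N) (x n))
        (split-< ∣ x m - x N ∣ ∣ x N - x n ∣ (tail x step m N≤m)
          (subst (_< ½ * ε) (dist-sym (x n) (x N)) (tail x step n N≤n)))

open RationalLemmas

abstract
  2^k-1≢0 : ∀ k .{{_ : ℕ.NonZero k}} → ℚ.NonZero (2ℚ ^ k ℚ.- 1ℚ)
  2^k-1≢0 (suc k) = ℚ.>-nonZero (0<2^[1+k]-1 k)

  0<1+½^k : ∀ k → 0ℚ ℚ.< 1ℚ ℚ.+ ½ ^ k
  0<1+½^k k = ℚP.<-≤-trans 0<1 (p≤p+q (ℚP.<⇒≤ (0<½^ k)))

1/[2^_-1] : (k : ℕ) → .{{ℕ.NonZero k}} → ℚ
1/[2^ k -1] = (1/ (2ℚ ^ k ℚ.- 1ℚ)) {{2^k-1≢0 k}}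

-- Real numbers are Cauchy sequences of rationals; equality of real numbers is _≃_, not _≡_.

IsCauchy : (ℕ → ℚ) → Set
IsCauchy x = ∀ ε → 0ℚ ℚ.< ε →
  ∃[ N ] ∀ m n → N ℕ.≤ m → N ℕ.≤ n → ℚ.∣ x m ℚ.- x n ∣ ℚ.< ε

record ℝ : Set where
  constructor mkℝ
  field
    seq    : ℕ → ℚ
    cauchy : IsCauchy seq
open ℝ public

infix  4 _≃_ _<_ _⟶_
infixl 6 _+_ _-_
infixl 7 _*_
infix  8 -_

_≃_ : ℝ → ℝ → Set
x ≃ y = ∀ ε → 0ℚ ℚ.< ε → ∃[ N ] ∀ n → N ℕ.≤ n → ℚ.∣ seq x n ℚ.- seq y n ∣ ℚ.< ε

_<_ : ℝ → ℝ → Set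
x < y = ∃[ δ ] (0ℚ ℚ.< δ) × ∃[ N ] ∀ n → N ℕ.≤ n → seq x n ℚ.+ δ ℚ.≤ seq y n

abstract
  const-cauchy : ∀ q → IsCauchy (λ _ → q)
  const-cauchy q ε 0<ε = 0 , λ _ _ _ _ → subst (ℚ._< ε) (sym (dist-refl q)) 0<ε

  +-cauchy : ∀ x y → IsCauchy x → IsCauchy y → IsCauchy (λ n → x n ℚ.+ y n)
  +-cauchy x y cx cy ε 0<ε with cx _ (½-pos 0<ε) | cy _ (½-pos 0<ε)
  ... | M , hx | N , hy = M ℕ.⊔ N , λ m n p q → ℚP.≤-<-trans
    (dist-+ (x m) (y m) (x n) (y n))
    (split-< ℚ.∣ x m ℚ.- x n ∣ ℚ.∣ y m ℚ.- y n ∣ (hx m n (ℕP.m⊔n≤o⇒m≤o M N p) (ℕP.m⊔n≤o⇒m≤o M N q))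
             (hy m n (ℕP.m⊔n≤o⇒n≤o M N p) (ℕP.m⊔n≤o⇒n≤o M N q)))

  neg-cauchy : ∀ x → IsCauchy x → IsCauchy (λ n → ℚ.- x n)
  neg-cauchy x cx ε 0<ε with cx ε 0<ε
  ... | N , h = N , λ m n p q → subst (ℚ._< ε) (sym (dist-neg (x m) (x n))) (h m n p q)

  abs-cauchy : ∀ x → IsCauchy x → IsCauchy (λ n → ℚ.∣ x n ∣)
  abs-cauchy x cx ε 0<ε with cx ε 0<ε
  ... | N , h = N , λ m n p q → ℚP.≤-<-trans (dist-abs (x m) (x n)) (h m n p q)

  cauchy-bounded : ∀ x → IsCauchy x → ∃[ B ] (0ℚ ℚ.< B) × ∀ n → ℚ.∣ x n ∣ ℚ.≤ B
  cauchy-bounded x cx with cx 1ℚ 0<1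
  ... | N , h = initial N ℚ.+ 1ℚ
              , ℚP.<-≤-trans 0<1 (q≤p+q (initial-nonNeg N))
              , bound
    where
    initial : ℕ → ℚ
    initial zero    = ℚ.∣ x 0 ∣
    initial (suc k) = initial k ℚ.+ ℚ.∣ x (suc k) ∣
    initial-nonNeg : ∀ k → 0ℚ ℚ.≤ initial k
    initial-nonNeg zero    = ℚP.0≤∣p∣ (x 0)
    initial-nonNeg (suc k) = ℚP.≤-trans (initial-nonNeg k) (p≤p+q (ℚP.0≤∣p∣ (x (suc k))))
    initial-last : ∀ k → ℚ.∣ x k ∣ ℚ.≤ initial k
    initial-last zero    = ℚP.≤-refl
    initial-last (suc k) = q≤p+q (initial-nonNeg k)
    initial-mono : ∀ {k l} → k ℕ.≤′ l → initial k ℚ.≤ initial l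
    initial-mono (ℕ.≤′-reflexive refl) = ℚP.≤-refl
    initial-mono (ℕ.≤′-step {l} p)     = ℚP.≤-trans (initial-mono p) (p≤p+q (ℚP.0≤∣p∣ (x (suc l))))
    bound : ∀ n → ℚ.∣ x n ∣ ℚ.≤ initial N ℚ.+ 1ℚ
    bound n with ℕP.≤-total n N
    ... | inj₁ n≤N = ℚP.≤-trans (initial-last n)
          (ℚP.≤-trans (initial-mono (ℕP.≤⇒≤′ n≤N)) (p≤p+q (ℚP.<⇒≤ 0<1)))
    ... | inj₂ N≤n = subst₂ ℚ._≤_ (cong ℚ.∣_∣ eq) refl
          (ℚP.≤-trans (ℚP.∣p+q∣≤∣p∣+∣q∣ (x N) (x n ℚ.- x N))
            (ℚP.+-mono-≤ (initial-last N) (ℚP.<⇒≤ (h n N N≤n ℕP.≤-refl))))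
      where
      open +-*-Solver
      eq : x N ℚ.+ (x n ℚ.- x N) ≡ x n
      eq = solve 2 (λ a b → a :+ (b :- a) := b) refl (x N) (x n)

  *-cauchy : ∀ x y → IsCauchy x → IsCauchy y → IsCauchy (λ n → x n ℚ.* y n)
  *-cauchy x y cx cy ε 0<ε with cauchy-bounded x cx | cauchy-bounded y cy
  ... | A , 0<A , hA | B , 0<B , hB with cy _ (*-pos (1/-pos 0<A) (½-pos 0<ε))
                                       | cx _ (*-pos (1/-pos 0<B) (½-pos 0<ε))
  ... | M , hy | N , hx = M ℕ.⊔ N , λ m n p q → ℚP.≤-<-trans
    (dist-* (x m) (y m) (x n) (y n))
    (split-< (ℚ.∣ x m ∣ ℚ.* ℚ.∣ y m ℚ.- y n ∣) (ℚ.∣ y n ∣ ℚ.* ℚ.∣ x m ℚ.- x n ∣)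
             (scale 0<A (x m) (y m ℚ.- y n) (hA m) (hy m n (ℕP.m⊔n≤o⇒m≤o M N p) (ℕP.m⊔n≤o⇒m≤o M N q)))
             (scale 0<B (y n) (x m ℚ.- x n) (hB n) (hx m n (ℕP.m⊔n≤o⇒n≤o M N p) (ℕP.m⊔n≤o⇒n≤o M N q))))
    where
    scale : ∀ {C} (0<C : 0ℚ ℚ.< C) a b → ℚ.∣ a ∣ ℚ.≤ C →
            ℚ.∣ b ∣ ℚ.< (1/ C) {{ℚ.>-nonZero 0<C}} ℚ.* (½ ℚ.* ε) → ℚ.∣ a ∣ ℚ.* ℚ.∣ b ∣ ℚ.< ½ ℚ.* ε
    scale {C} 0<C a b ha hb = ℚP.≤-<-trans
      (ℚP.*-monoʳ-≤-nonNeg ℚ.∣ b ∣ {{ℚ.nonNegative (ℚP.0≤∣p∣ b)}} ha)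
      (subst (C ℚ.* ℚ.∣ b ∣ ℚ.<_)
        (trans (sym (ℚP.*-assoc C _ _))
          (trans (cong (ℚ._* (½ ℚ.* ε)) (ℚP.*-inverseʳ C {{ℚ.>-nonZero 0<C}})) (ℚP.*-identityˡ _)))
        (ℚP.*-monoʳ-<-pos C {{ℚ.positive 0<C}} hb))

ι : ℚ → ℝ
ι q = mkℝ (λ _ → q) (const-cauchy q)

_+_ : ℝ → ℝ → ℝ
x + y = mkℝ (λ n → seq x n ℚ.+ seq y n) (+-cauchy (seq x) (seq y) (cauchy x) (cauchy y))

-_ : ℝ → ℝ
- x = mkℝ (λ n → ℚ.- seq x n) (neg-cauchy (seq x) (cauchy x))

_-_ : ℝ → ℝ → ℝ
x - y = x + - y

_*_ : ℝ → ℝ → ℝ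
x * y = mkℝ (λ n → seq x n ℚ.* seq y n) (*-cauchy (seq x) (seq y) (cauchy x) (cauchy y))

∣_∣ : ℝ → ℝ
∣ x ∣ = mkℝ (λ n → ℚ.∣ seq x n ∣) (abs-cauchy (seq x) (cauchy x))

_⟶_ : (ℕ → ℝ) → ℝ → Set
s ⟶ x = ∀ ε → 0ℚ ℚ.< ε → ∃[ N ] ∀ n → N ℕ.≤ n → ∣ s n - x ∣ < ι ε

IsCauchyℝ : (ℕ → ℝ) → Set
IsCauchyℝ s = ∀ ε → 0ℚ ℚ.< ε →
  ∃[ N ] ∀ m n → N ℕ.≤ m → N ℕ.≤ n → ∣ s m - s n ∣ < ι ε

∑ : (ℕ → ℝ) → ℕ → ℝ
∑ f zero    = ι 0ℚ
∑ f (suc k) = ∑ f k + f k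

-- Completeness (see lim-converges): the k-th approximant of the limit is a rational within ½ ^ k of s n,
-- for some n from which point on the s n are within ½ ^ k of each other.
module _ (s : ℕ → ℝ) (c : IsCauchyℝ s) where
  private
    index : ℕ → ℕ
    index k = proj₁ (c (½ ^ k) (0<½^ k))

    place : ℕ → ℕ
    place k = proj₁ (cauchy (s (index k)) (½ ^ k) (0<½^ k))

    approx : ℕ → ℚ
    approx k = seq (s (index k)) (place k)

  abstract
    private
      near : ∀ k n → index k ℕ.≤ n →
             ∃[ I ] ∀ i → I ℕ.≤ i → ℚ.∣ seq (s n) i ℚ.- approx k ∣ ℚ.< 2ℚ ℚ.* ½ ^ k
      near k n h = J ℕ.⊔ place k , λ i q →
        subst (ℚ.∣ seq (s n) i ℚ.- approx k ∣ ℚ.<_)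
          (solve 1 (λ t → t :+ t := con 2ℚ :* t) refl (½ ^ k))
          (ℚP.≤-<-trans (dist-triangle (seq (s n) i) (seq (s (index k)) i) (approx k))
            (ℚP.+-mono-< {ℚ.∣ seq (s n) i ℚ.- seq (s (index k)) i ∣} {½ ^ k}
              (p+δ≤q⇒p<q (proj₁ (proj₂ close)) (proj₂ (proj₂ (proj₂ close)) i (ℕP.m⊔n≤o⇒m≤o J (place k) q)))
              (proj₂ (cauchy (s (index k)) (½ ^ k) (0<½^ k)) i (place k)
                (ℕP.m⊔n≤o⇒n≤o J (place k) q) ℕP.≤-refl)))
        where
        open +-*-Solver
        close : ∣ s n - s (index k) ∣ < ι (½ ^ k)
        close = proj₂ (c (½ ^ k) (0<½^ k)) n (index k) h ℕP.≤-refl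
        J : ℕ
        J = proj₁ (proj₂ (proj₂ close))

      approx-near : ∀ k l → ℚ.∣ approx k ℚ.- approx l ∣ ℚ.< 2ℚ ℚ.* ½ ^ k ℚ.+ 2ℚ ℚ.* ½ ^ l
      approx-near k l = ℚP.≤-<-trans
        (dist-triangle (approx k) a (approx l))
        (ℚP.+-mono-< {ℚ.∣ approx k ℚ.- a ∣} {2ℚ ℚ.* ½ ^ k}
          (subst (ℚ._< 2ℚ ℚ.* ½ ^ k) (dist-sym a (approx k)) (proj₂ nk i (ℕP.m≤m⊔n (proj₁ nk) (proj₁ nl))))
          (proj₂ nl i (ℕP.m≤n⊔m (proj₁ nk) (proj₁ nl))))
        where
        n : ℕ
        n = index k ℕ.⊔ index l
        nk : ∃[ I ] ∀ i → I ℕ.≤ i → ℚ.∣ seq (s n) i ℚ.- approx k ∣ ℚ.< 2ℚ ℚ.* ½ ^ k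
        nk = near k n (ℕP.m≤m⊔n (index k) (index l))
        nl : ∃[ I ] ∀ i → I ℕ.≤ i → ℚ.∣ seq (s n) i ℚ.- approx l ∣ ℚ.< 2ℚ ℚ.* ½ ^ l
        nl = near l n (ℕP.m≤n⊔m (index k) (index l))
        i : ℕ
        i = proj₁ nk ℕ.⊔ proj₁ nl
        a : ℚ
        a = seq (s n) i

      small : ∀ ε → 0ℚ ℚ.< ε → ∃[ N ] ∀ k → N ℕ.≤ k → 2ℚ ℚ.* ½ ^ k ℚ.< ε
      small ε 0<ε with ½^-small 2ℚ 0<ε
      ... | N , h = N , λ k N≤k → ℚP.≤-<-trans (ℚP.*-monoˡ-≤-nonNeg 2ℚ (½^-anti N≤k)) h

    lim-cauchy : IsCauchy approx
    lim-cauchy ε 0<ε with small _ (½-pos 0<ε)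
    ... | N , h = N , λ m n p q → ℚP.<-trans (approx-near m n) (split-< (2ℚ ℚ.* ½ ^ m) (2ℚ ℚ.* ½ ^ n) (h m p) (h n q))

  lim : ℝ
  lim = mkℝ approx lim-cauchy

  abstract
    lim-converges : s ⟶ lim
    lim-converges ε 0<ε with small _ (½-pos (½-pos 0<ε))
    ... | N , h = index N , λ n p → conv n (near N n p)
      where
      conv : ∀ n → ∃[ I ] (∀ i → I ℕ.≤ i → ℚ.∣ seq (s n) i ℚ.- approx N ∣ ℚ.< 2ℚ ℚ.* ½ ^ N) →
             ∣ s n - lim ∣ < ι ε
      conv n (I , hI) = ½ ℚ.* (½ ℚ.* ε) , ½-pos (½-pos 0<ε) , I ℕ.⊔ N , λ i q →
        subst (ℚ.∣ seq (s n) i ℚ.- approx i ∣ ℚ.+ ½ ℚ.* (½ ℚ.* ε) ℚ.≤_)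
          (solve 1 (λ e → ((con ½ :* (con ½ :* e)) :+ ((con ½ :* (con ½ :* e)) :+ (con ½ :* (con ½ :* e))))
                            :+ con ½ :* (con ½ :* e) := e) refl ε)
          (ℚP.+-monoˡ-≤ (½ ℚ.* (½ ℚ.* ε)) (ℚP.≤-trans
            (dist-triangle (seq (s n) i) (approx N) (approx i))
            (ℚP.+-mono-≤ {ℚ.∣ seq (s n) i ℚ.- approx N ∣} {½ ℚ.* (½ ℚ.* ε)}
              (ℚP.<⇒≤ (ℚP.<-trans (hI i (ℕP.m⊔n≤o⇒m≤o I N q)) (h N ℕP.≤-refl)))
              (ℚP.<⇒≤ (ℚP.<-trans (approx-near N i)
                (ℚP.+-mono-< {2ℚ ℚ.* ½ ^ N} {½ ℚ.* (½ ℚ.* ε)} (h N ℕP.≤-refl) (h i (ℕP.m⊔n≤o⇒n≤o I N q))))))))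
        where open +-*-Solver

eulerFactor : (j : ℕ) → .{{ℕ.NonZero j}} → ℚ
eulerFactor j = (1/ (1ℚ ℚ.+ ½ ^ j)) {{ℚ.>-nonZero (0<1+½^k j)}}

αFactor : (j : ℕ) → .{{ℕ.NonZero j}} → ℚ
αFactor j = 2ℚ ℚ.* 1/[2^ j -1]

abstract
  eulerFactor-pos : ∀ J → 0ℚ ℚ.< eulerFactor (suc J)
  eulerFactor-pos J = 1/-pos (0<1+½^k (suc J))

  eulerFactor-≤1 : ∀ J → eulerFactor (suc J) ℚ.≤ 1ℚ
  eulerFactor-≤1 J = 1/-≤ (0<1+½^k (suc J))
    (subst (1ℚ ℚ.≤_) (sym (ℚP.*-identityʳ _)) (p≤p+q (ℚP.<⇒≤ (0<½^ (suc J)))))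

  eulerProduct-bounds : ∀ J → (0ℚ ℚ.≤ ∏₁ eulerFactor J) × (∏₁ eulerFactor J ℚ.≤ 1ℚ)
  eulerProduct-bounds zero    = ℚP.<⇒≤ 0<1 , ℚP.≤-refl
  eulerProduct-bounds (suc J) with eulerProduct-bounds J
  ... | 0≤p , p≤1 = *-nonNeg 0≤p (ℚP.<⇒≤ (eulerFactor-pos J))
                  , *-mono-≤-nonNeg (ℚP.<⇒≤ (eulerFactor-pos J)) (ℚP.<⇒≤ 0<1) p≤1 (eulerFactor-≤1 J)

  eulerProduct-step : ∀ J → ℚ.∣ ∏₁ eulerFactor (suc J) ℚ.- ∏₁ eulerFactor J ∣ ℚ.≤ 1ℚ ℚ.* ½ ^ J
  eulerProduct-step J = subst (ℚ._≤ 1ℚ ℚ.* ½ ^ J) (sym eq)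
    (*-mono-≤-nonNeg (ℚP.<⇒≤ (0<½^ (suc J))) (ℚP.<⇒≤ 0<1)
      (proj₂ (eulerProduct-bounds (suc J))) (½^-step J))
    where
    open +-*-Solver
    p f t : ℚ
    p = ∏₁ eulerFactor J
    f = eulerFactor (suc J)
    t = ½ ^ suc J
    diff : p ℚ.* f ℚ.- p ≡ ℚ.- ((p ℚ.* f) ℚ.* t)
    diff = trans
      (cong (λ q → p ℚ.* f ℚ.- q)
        (trans (sym (ℚP.*-identityʳ p)) (cong (p ℚ.*_) (sym (ℚP.*-inverseˡ (1ℚ ℚ.+ t) {{ℚ.>-nonZero (0<1+½^k (suc J))}})))))
      (solve 3 (λ p f t → p :* f :- p :* (f :* (con 1ℚ :+ t)) := :- ((p :* f) :* t)) refl p f t)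
    eq : ℚ.∣ p ℚ.* f ℚ.- p ∣ ≡ (p ℚ.* f) ℚ.* t
    eq = trans (cong ℚ.∣_∣ diff) (trans (ℚP.∣-p∣≡∣p∣ ((p ℚ.* f) ℚ.* t))
      (ℚP.0≤p⇒∣p∣≡p (*-nonNeg (proj₁ (eulerProduct-bounds (suc J))) (ℚP.<⇒≤ (0<½^ (suc J))))))

  eulerProduct-cauchy : IsCauchy (∏₁ eulerFactor)
  eulerProduct-cauchy ε 0<ε with geometric-cauchy 1ℚ (ℚP.<⇒≤ 0<1) ε 0<ε
  ... | N , h = N , h (∏₁ eulerFactor) eulerProduct-step

-- The infinite product over j ≥ 1 of (1 + 2 ^ (- j)) ^ (- 1): as its partial products are
-- rational and Cauchy, they represent their own limit.
eulerProduct : ℝ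
eulerProduct = mkℝ (∏₁ eulerFactor) eulerProduct-cauchy

α : ℕ → ℝ
α r = eulerProduct * ι (∏₁ αFactor r)

-- The m ∈ {0, 1} with m ≡ n + 1 (mod 2).
m : ℕ → ℕ
m n = (n ℕ.+ 1) % 2

abstract
  exponent-bound : ∀ n r → r ℕ.< n ℕ.+ 2 ℕ.* r ℕ.+ m n
  exponent-bound zero    r = subst (r ℕ.<_) (ℕP.+-comm 1 (2 ℕ.* r)) (ℕ.s≤s (ℕP.m≤m+n r _))
  exponent-bound (suc n) r = ℕ.s≤s (ℕP.≤-trans (ℕP.≤-trans (ℕP.m≤m+n r _) (ℕP.m≤n+m _ n)) (ℕP.m≤m+n _ (m (suc n))))

  exponent≢0 : ∀ n r → ℕ.NonZero (n ℕ.+ 2 ℕ.* r ℕ.+ m n)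
  exponent≢0 n r = ℕ.>-nonZero (ℕP.≤-<-trans ℕ.z≤n (exponent-bound n r))

βTerm : ℕ → ℕ → ℝ
βTerm n r = α (2 ℕ.* r ℕ.+ m n) * ι (1/[2^ n ℕ.+ 2 ℕ.* r ℕ.+ m n -1] {{exponent≢0 n r}})

abstract
  αFactor-nonNeg : ∀ j → 0ℚ ℚ.≤ αFactor (suc j)
  αFactor-nonNeg j = *-nonNeg (ℚP.nonNegative⁻¹ 2ℚ) (ℚP.<⇒≤ (1/-pos (0<2^[1+k]-1 j)))

  αFactor-≤1 : ∀ j → αFactor (suc (suc j)) ℚ.≤ 1ℚ
  αFactor-≤1 j = ℚP.≤-trans
    (ℚP.*-monoˡ-≤-nonNeg 2ℚ (ℚP.≤-trans (1/[2^[1+k]-1]≤½^k (suc j)) (½^-anti {1} {suc j} (ℕ.s≤s ℕ.z≤n))))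
    (ℚP.≤-reflexive refl)

  αProduct-bounds : ∀ r → (0ℚ ℚ.≤ ∏₁ αFactor r) × (∏₁ αFactor r ℚ.≤ 2ℚ)
  αProduct-bounds zero          = ℚP.<⇒≤ 0<1 , p≤p+q {1ℚ} {1ℚ} (ℚP.<⇒≤ 0<1)
  αProduct-bounds (suc zero)    = ℚP.nonNegative⁻¹ 2ℚ , ℚP.≤-refl
  αProduct-bounds (suc (suc r)) with αProduct-bounds (suc r)
  ... | 0≤a , a≤2 = *-nonNeg 0≤a (αFactor-nonNeg (suc r))
                  , *-mono-≤-nonNeg (αFactor-nonNeg (suc r)) (ℚP.nonNegative⁻¹ 2ℚ) a≤2 (αFactor-≤1 r)

  0≤1/[2^e-1]≤½^r : ∀ e r → .{{_ : ℕ.NonZero e}} → r ℕ.< e →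
    (0ℚ ℚ.≤ 1/[2^ e -1]) × (1/[2^ e -1] ℚ.≤ ½ ^ r)
  0≤1/[2^e-1]≤½^r (suc e) r (ℕ.s≤s r≤e) =
    ℚP.<⇒≤ (1/-pos (0<2^[1+k]-1 e)) , ℚP.≤-trans (1/[2^[1+k]-1]≤½^k e) (½^-anti r≤e)

  triple-bound : ∀ {p a e t} → (0ℚ ℚ.≤ p) × (p ℚ.≤ 1ℚ) → (0ℚ ℚ.≤ a) × (a ℚ.≤ 2ℚ) →
    (0ℚ ℚ.≤ e) × (e ℚ.≤ t) → ℚ.∣ (p ℚ.* a) ℚ.* e ∣ ℚ.≤ 2ℚ ℚ.* t
  triple-bound {p} {a} {e} {t} (0≤p , p≤1) (0≤a , a≤2) (0≤e , e≤t) = subst (ℚ._≤ 2ℚ ℚ.* t)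
    (sym (ℚP.0≤p⇒∣p∣≡p (*-nonNeg {p ℚ.* a} {e} (*-nonNeg 0≤p 0≤a) 0≤e)))
    (*-mono-≤-nonNeg {p ℚ.* a} {2ℚ} 0≤e (ℚP.nonNegative⁻¹ 2ℚ)
      (*-mono-≤-nonNeg {p} {1ℚ} {a} {2ℚ} 0≤a (ℚP.<⇒≤ 0<1) p≤1 a≤2) e≤t)

  βTerm-bound : ∀ n r i → ℚ.∣ seq (βTerm n r) i ∣ ℚ.≤ 2ℚ ℚ.* ½ ^ r
  βTerm-bound n r i = triple-bound (eulerProduct-bounds i) (αProduct-bounds (2 ℕ.* r ℕ.+ m n))
    (0≤1/[2^e-1]≤½^r (n ℕ.+ 2 ℕ.* r ℕ.+ m n) r {{exponent≢0 n r}} (exponent-bound n r))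

  series-cauchy : ∀ (f : ℕ → ℝ) c → 0ℚ ℚ.≤ c →
    (∀ k i → ℚ.∣ seq (f k) i ∣ ℚ.≤ c ℚ.* ½ ^ k) → IsCauchyℝ (∑ f)
  series-cauchy f c 0≤c bound ε 0<ε = proj₁ modulus , close
    where
    open +-*-Solver
    partial : ℕ → ℕ → ℚ
    partial i k = seq (∑ f k) i
    modulus : ∃[ N ] ∀ (x : ℕ → ℚ) → (∀ k → ℚ.∣ x (suc k) ℚ.- x k ∣ ℚ.≤ c ℚ.* ½ ^ k) →
              ∀ k l → N ℕ.≤ k → N ℕ.≤ l → ℚ.∣ x k ℚ.- x l ∣ ℚ.< ½ ℚ.* ε
    modulus = geometric-cauchy c 0≤c (½ ℚ.* ε) (½-pos 0<ε)
    step : ∀ i k → ℚ.∣ partial i (suc k) ℚ.- partial i k ∣ ℚ.≤ c ℚ.* ½ ^ k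
    step i k = subst (λ q → ℚ.∣ q ∣ ℚ.≤ c ℚ.* ½ ^ k)
      (solve 2 (λ s t → t := (s :+ t) :- s) refl (partial i k) (seq (f k) i))
      (bound k i)
    within : ∀ k l → proj₁ modulus ℕ.≤ k → proj₁ modulus ℕ.≤ l → ∀ i →
             ℚ.∣ partial i k ℚ.- partial i l ∣ ℚ.+ ½ ℚ.* ε ℚ.≤ ε
    within k l p q i = subst (ℚ.∣ partial i k ℚ.- partial i l ∣ ℚ.+ ½ ℚ.* ε ℚ.≤_) (½+½ ε)
      (ℚP.+-monoˡ-≤ (½ ℚ.* ε) (ℚP.<⇒≤ (proj₂ modulus (partial i) (step i) k l p q)))
    close : ∀ k l → proj₁ modulus ℕ.≤ k → proj₁ modulus ℕ.≤ l → ∣ ∑ f k - ∑ f l ∣ < ι ε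
    close k l p q = ½ ℚ.* ε , ½-pos 0<ε , 0 , λ i _ → within k l p q i

  βSum-cauchy : ∀ n → IsCauchyℝ (∑ (βTerm n))
  βSum-cauchy n = series-cauchy (βTerm n) 2ℚ (ℚP.nonNegative⁻¹ 2ℚ) (βTerm-bound n)

-- The series converges, and β is defined, for n = 0 as well.
β : ℕ → ℝ
β n = lim (∑ (βTerm n)) (βSum-cauchy n)

{-# OPTIONS --safe #-}

-- With a_k = ∏_{j≤k} 2/(2^j − 1) and n = n′ + 1, the recurrence (2^(k+1) − 1) a_(k+1) = 2 a_k gives
--   2^n a_k / (2^(n′+k+1) − 1) + (2^n′ − 1) a_(k+1) / (2^(n′+k+1) − 1) = a_(k+1),
-- and as n + m(n) is odd, the exponents in β_n and β_n′ are the same odd numbers.  So summing over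
-- the odd exponents turns 2^n β_n + (2^n′ − 1) β_n′ into the sum of the α(k) over one parity class
-- of k, and it remains to see that each parity class has total 1 (n = 1 gives β_1 = 1/2).
-- The series F(z) = Σ a_k z^k satisfies F(z) = (1 + z) F(z/2).  Hence F(−1) = 0, and iterating from
-- z = 1 gives F(1) = 2 ∏_{j≥1} (1 + 2^(−j)), so Σ α(k) = 2 and Σ (−1)^k α(k) = 0.  All this is done
-- on partial sums, with explicit error terms.

module Submission where

open import Defs hiding (_+_; _-_; _*_; -_; ∣_∣; _<_)
import Defs as Real
open RationalLemmas
open import Data.Nat.Base as ℕ using (ℕ; zero; suc)
import Data.Nat.Properties as ℕP
open import Data.Product using (∃-syntax; _×_; _,_; proj₁; proj₂)
open import Data.Sum using (_⊎_; inj₁; inj₂)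
open import Data.Rational.Base as ℚ using (ℚ; 0ℚ; 1ℚ; ½)
open import Relation.Binary.PropositionalEquality
  using (_≡_; refl; sym; trans; cong; cong₂; subst; subst₂)

double : ℕ → ℕ
double zero    = zero
double (suc K) = suc (suc (double K))

module _ where
  open import Data.Rational.Base hiding (_≃_)
  open import Data.Rational.Properties
  open import Data.Rational.Solver using (module +-*-Solver)
  open +-*-Solver

  -- Truncated generating series and their functional equation.

  3ℚ 4ℚ 6ℚ 8ℚ : ℚ
  3ℚ = 2ℚ + 1ℚ
  4ℚ = 2ℚ + 2ℚ
  6ℚ = 4ℚ + 2ℚ
  8ℚ = 4ℚ + 4ℚ

  a : ℕ → ℚ
  a = ∏₁ αFactor

  P : ℕ → ℚ
  P = ∏₁ eulerFactor

  F : ℕ → ℚ → ℚ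
  F zero    z = 1ℚ
  F (suc N) z = F N z + a (suc N) * z ^ suc N

  evenSum : ℕ → ℚ
  evenSum zero    = 0ℚ
  evenSum (suc K) = evenSum K + a (double K)

  oddSum : ℕ → ℚ
  oddSum zero    = 0ℚ
  oddSum (suc K) = oddSum K + a (suc (double K))

  abstract
    2^k-1-inverse : ∀ k .{{_ : ℕ.NonZero k}} → (2ℚ ^ k - 1ℚ) * 1/[2^ k -1] ≡ 1ℚ
    2^k-1-inverse k = *-inverseʳ (2ℚ ^ k - 1ℚ) {{2^k-1≢0 k}}

    a-recurrence : ∀ k → (2ℚ ^ suc k - 1ℚ) * a (suc k) ≡ 2ℚ * a k
    a-recurrence k = trans
      (solve 3 (λ x y u → x :* (y :* (con 2ℚ :* u)) := (x :* u) :* (con 2ℚ :* y)) refl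
        (2ℚ ^ suc k - 1ℚ) (a k) 1/[2^ suc k -1])
      (trans (cong (_* (2ℚ * a k)) (2^k-1-inverse (suc k))) (*-identityˡ _))

    ^-halve : ∀ z N → z ^ N ≡ 2ℚ ^ N * (½ * z) ^ N
    ^-halve z zero    = refl
    ^-halve z (suc N) = trans (cong (z *_) (^-halve z N))
      (solve 3 (λ z s t → z :* (s :* t) := (con 2ℚ :* s) :* ((con ½ :* z) :* t)) refl
        z (2ℚ ^ N) ((½ * z) ^ N))

    -- Comparing coefficients of z^(k+1) in F(z) = (1 + z) F(z/2) gives exactly `a-recurrence`.
    -- Truncation leaves the top term of z F(z/2) unmatched, hence the extra summand on the left.
    F-functional : ∀ N z → F N z + z * ((½ * z) ^ N * a N) ≡ (1ℚ + z) * F N (½ * z)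
    F-functional zero    z = solve 1 (λ z → con 1ℚ :+ z :* con 1ℚ := (con 1ℚ :+ z) :* con 1ℚ) refl z
    F-functional (suc N) z = trans
      (cong (λ s → (F N z + a (suc N) * (z * s)) + z * ((½ * z) * t * a (suc N))) (^-halve z N))
      (trans
        -- What the induction hypothesis does not cover is collected into a multiple of (2^(N+1) -
        -- 1) a_(N+1) - 2 a_N, which vanishes.
        (solve 6 (λ f z t p b c →
            (f :+ c :* (z :* (p :* t))) :+ z :* ((con ½ :* z) :* t :* c)
            := (f :+ z :* (t :* b)) :+ (con 1ℚ :+ z) :* (c :* ((con ½ :* z) :* t))
               :+ con ½ :* z :* t :* ((con 2ℚ :* p :- con 1ℚ) :* c :- con 2ℚ :* b))
          refl (F N z) z t (2ℚ ^ N) (a N) (a (suc N)))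
        (trans
          (cong₂ (λ x y → x + (1ℚ + z) * (a (suc N) * ((½ * z) * t)) + ½ * z * t * (y - 2ℚ * a N))
            (F-functional N z) (a-recurrence N))
          (solve 5 (λ g z t b c →
              (con 1ℚ :+ z) :* g :+ (con 1ℚ :+ z) :* (c :* ((con ½ :* z) :* t))
               :+ con ½ :* z :* t :* (con 2ℚ :* b :- con 2ℚ :* b)
              := (con 1ℚ :+ z) :* (g :+ c :* ((con ½ :* z) :* t)))
            refl (F N (½ * z)) z t (a N) (a (suc N)))))
      where
      t : ℚ
      t = (½ * z) ^ N

    even-power : ∀ z → z * z ≡ 1ℚ → ∀ K → z ^ double K ≡ 1ℚ
    even-power z zz≡1 zero = refl
    even-power z zz≡1 (suc K) = trans (sym (*-assoc z z _)) (cong₂ _*_ zz≡1 (even-power z zz≡1 K))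

    -- Meant for z = 1 and z = -1, whose half-sum and half-difference isolate the parity classes.
    -- The odd degree gives both classes equally many terms.
    F-parity : ∀ z → z * z ≡ 1ℚ → ∀ K →
      F (suc (double K)) z ≡ evenSum (suc K) + z * oddSum (suc K)
    F-parity z zz≡1 zero = solve 2 (λ z b → con 1ℚ :+ b :* (z :* con 1ℚ)
      := (con 0ℚ :+ con 1ℚ) :+ z :* (con 0ℚ :+ b)) refl z (a 1)
    F-parity z zz≡1 (suc K) = trans
      (cong₂ (λ f s → (f + a (2 ℕ.+ double K) * s) + a (3 ℕ.+ double K) * (z * s))
        (F-parity z zz≡1 K) (even-power z zz≡1 (suc K)))
      (solve 5 (λ e o z b c → ((e :+ z :* o) :+ b :* con 1ℚ) :+ c :* (z :* con 1ℚ)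
         := (e :+ b) :+ z :* (o :+ c)) refl
        (evenSum (suc K)) (oddSum (suc K)) z (a (2 ℕ.+ double K)) (a (3 ℕ.+ double K)))

    -- Bounds for the truncations at small arguments.

    p≤q⇒0≤q-p : ∀ {p q} → p ≤ q → 0ℚ ≤ q - p
    p≤q⇒0≤q-p {p} {q} h = subst (_≤ q - p) (+-inverseʳ p) (+-monoˡ-≤ (- p) h)

    p-q≤p : ∀ {p q} → 0ℚ ≤ q → p - q ≤ p
    p-q≤p {p} {q} h = p-q≤r {p} {q} {p} (p≤p+q h)

    0≤a : ∀ N → 0ℚ ≤ a N
    0≤a N = proj₁ (αProduct-bounds N)

    0≤½^ : ∀ k → 0ℚ ≤ ½ ^ k
    0≤½^ k = <⇒≤ (0<½^ k)

    ½^≤1 : ∀ k → ½ ^ k ≤ 1ℚ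
    ½^≤1 k = ½^-anti {0} {k} ℕ.z≤n

    eulerFactor-inverse : ∀ j → eulerFactor (suc j) * (1ℚ + ½ ^ suc j) ≡ 1ℚ
    eulerFactor-inverse j = *-inverseˡ (1ℚ + ½ ^ suc j) {{>-nonZero (0<1+½^k (suc j))}}

    module _ (z : ℚ) (0≤z : 0ℚ ≤ z) where
      ^-nonNeg : ∀ N → 0ℚ ≤ z ^ N
      ^-nonNeg zero    = <⇒≤ 0<1
      ^-nonNeg (suc N) = *-nonNeg 0≤z (^-nonNeg N)

      module _ (z≤½ : z ≤ ½) where
        ^≤½^ : ∀ N → z ^ N ≤ ½ ^ N
        ^≤½^ zero    = ≤-refl
        ^≤½^ (suc N) = *-mono-≤-nonNeg (^-nonNeg N) (<⇒≤ 0<½) z≤½ (^≤½^ N)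

        1≤F : ∀ N → 1ℚ ≤ F N z
        1≤F zero    = ≤-refl
        1≤F (suc N) = ≤-trans (1≤F N) (p≤p+q (*-nonNeg (0≤a (suc N)) (^-nonNeg (suc N))))

        -- As a_(k+1) ≤ 2 and z ≤ ½, the term of degree k + 1 is at most 2 z ½^k; these add up to 4
        -- z (1 - ½^N). The factor z is kept because the bound is applied as z tends to 0.
        F≤ : ∀ N → F N z ≤ 1ℚ + (4ℚ * z) * (1ℚ - ½ ^ N)
        F≤ zero    = ≤-reflexive (solve 1 (λ z → con 1ℚ := con 1ℚ :+ (con 4ℚ :* z) :* (con 1ℚ :- con 1ℚ)) refl z)
        F≤ (suc N) = subst (F (suc N) z ≤_)
          (solve 2 (λ z t → (con 1ℚ :+ (con 4ℚ :* z) :* (con 1ℚ :- t)) :+ con 2ℚ :* (z :* t)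
             := con 1ℚ :+ (con 4ℚ :* z) :* (con 1ℚ :- con ½ :* t)) refl z (½ ^ N))
          (+-mono-≤ (F≤ N) (*-mono-≤-nonNeg (^-nonNeg (suc N)) (nonNegative⁻¹ 2ℚ)
            (proj₂ (αProduct-bounds (suc N)))
            (*-monoˡ-≤-nonNeg z {{nonNegative 0≤z}} (^≤½^ N))))

    ½^[1+i]≤½ : ∀ i → ½ ^ suc i ≤ ½
    ½^[1+i]≤½ i = ½^-anti {1} {suc i} (ℕ.s≤s ℕ.z≤n)

    -- The value at 1, by iterating the functional equation.

    -- The error made, for the truncation at degree N, by iterating F(z) = (1 + z) F(z/2) from z = 1.
    error : ℕ → ℕ → ℚ
    error N i = 2ℚ * F N (½ ^ suc i) - P i * F N 1ℚ

    -- The truncation term of `F-functional` at z = ½^i.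
    defect : ℕ → ℕ → ℚ
    defect N i = ½ ^ i * ((½ ^ suc i) ^ N * a N)

    error-zero : ∀ N → error N 0 ≡ defect N 0
    error-zero N = trans
      (cong (_- 1ℚ * F N 1ℚ) (sym (F-functional N 1ℚ)))
      (solve 2 (λ f d → (f :+ d) :- con 1ℚ :* f := d) refl (F N 1ℚ) (defect N 0))

    -- This is `F-functional` at z = ½^(i+1), multiplied by the Euler factor inverse to 1 + z.
    error-suc : ∀ N i → error N (suc i) ≡ eulerFactor (suc i) * (error N i + 2ℚ * defect N (suc i))
    error-suc N i = trans
      (cong (λ x → 2ℚ * x - (P i * f) * F N 1ℚ)
        (trans (sym (*-identityˡ (F N (½ ^ suc (suc i)))))
        (trans (cong (_* F N (½ ^ suc (suc i))) (sym (eulerFactor-inverse i)))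
        (trans (*-assoc f _ _) (cong (f *_) (sym (F-functional N (½ ^ suc i))))))))
      (solve 5 (λ f g d p h → con 2ℚ :* (f :* (g :+ d)) :- (p :* f) :* h
          := f :* ((con 2ℚ :* g :- p :* h) :+ con 2ℚ :* d)) refl
        f (F N (½ ^ suc i)) (defect N (suc i)) (P i) (F N 1ℚ))
      where
      f : ℚ
      f = eulerFactor (suc i)

    defect-bounds : ∀ N i → (0ℚ ≤ defect N i) × (defect N i ≤ ½ ^ i * (½ ^ N * a N))
    defect-bounds N i
      = *-nonNeg (0≤½^ i) (*-nonNeg (^-nonNeg _ (0≤½^ (suc i)) N) (0≤a N))
      , *-monoˡ-≤-nonNeg (½ ^ i) {{nonNegative (0≤½^ i)}}
          (*-monoʳ-≤-nonNeg (a N) {{nonNegative (0≤a N)}}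
            (^≤½^ _ (0≤½^ (suc i)) (½^[1+i]≤½ i) N))

    -- Euler factors are at most 1, so errors only accumulate defects: that at 0 once, those at 1,
    -- ..., i twice. Since the defect at j is at most ½^j times `½ ^ N * a N`, the total weight is 1
    -- + 2 (1 - ½^i) = 3 - 2 ½^i.
    error-bounds : ∀ N i → (0ℚ ≤ error N i) × (error N i ≤ (½ ^ N * a N) * (3ℚ - 2ℚ * ½ ^ i))
    error-bounds N zero = subst (λ x → (0ℚ ≤ x) × (x ≤ (½ ^ N * a N) * (3ℚ - 2ℚ * 1ℚ)))
      (sym (error-zero N))
      (proj₁ (defect-bounds N 0) , subst (defect N 0 ≤_) (*-comm 1ℚ (½ ^ N * a N)) (proj₂ (defect-bounds N 0)))
    error-bounds N (suc i) = subst (λ x → (0ℚ ≤ x) × (x ≤ b * (3ℚ - 2ℚ * ½ ^ suc i)))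
      (sym (error-suc N i))
      ( *-nonNeg (<⇒≤ (eulerFactor-pos i)) 0≤y
      , ≤-trans (*-monoʳ-≤-nonNeg y {{nonNegative 0≤y}} (eulerFactor-≤1 i))
          (subst₂ _≤_ (sym (*-identityˡ y))
            (solve 2 (λ b t → b :* (con 3ℚ :- con 2ℚ :* t) :+ con 2ℚ :* ((con ½ :* t) :* b)
               := b :* (con 3ℚ :- con 2ℚ :* (con ½ :* t))) refl b (½ ^ i))
            (+-mono-≤ (proj₂ (error-bounds N i)) (*-monoˡ-≤-nonNeg 2ℚ (proj₂ (defect-bounds N (suc i)))))))
      where
      b y : ℚ
      b = ½ ^ N * a N
      y = error N i + 2ℚ * defect N (suc i)
      0≤y : 0ℚ ≤ y
      0≤y = +-mono-≤ {0ℚ} (proj₁ (error-bounds N i))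
        (*-nonNeg (nonNegative⁻¹ 2ℚ) (proj₁ (defect-bounds N (suc i))))

    -- The difference is 2 (F(z) - 1) minus the error, at z = ½^(i+1). The former is at most 8 z = 4
    -- ½^i by `F≤`, the latter at most 3 · 2 · ½^N.
    total-bound : ∀ N i → ∣ P i * F N 1ℚ - 2ℚ ∣ ≤ 4ℚ * ½ ^ i + 6ℚ * ½ ^ N
    total-bound N i = subst (λ x → ∣ x ∣ ≤ 4ℚ * ½ ^ i + 6ℚ * ½ ^ N)
      (solve 2 (λ f x → con 2ℚ :* (f :- con 1ℚ) :- (con 2ℚ :* f :- x) := x :- con 2ℚ) refl
        (F N z) (P i * F N 1ℚ))
      (≤-trans (∣p-q∣≤∣p∣+∣q∣ (2ℚ * (F N z - 1ℚ)) (error N i))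
        (+-mono-≤
          (subst (_≤ 4ℚ * ½ ^ i) (sym (0≤p⇒∣p∣≡p (*-nonNeg (nonNegative⁻¹ 2ℚ) 0≤F-1)))
            (subst (2ℚ * (F N z - 1ℚ) ≤_)
              (solve 1 (λ t → con 2ℚ :* ((con 4ℚ :* (con ½ :* t)) :* con 1ℚ) := con 4ℚ :* t) refl (½ ^ i))
              (*-monoˡ-≤-nonNeg 2ℚ F-1≤)))
          (subst (_≤ 6ℚ * ½ ^ N) (sym (0≤p⇒∣p∣≡p (proj₁ (error-bounds N i))))
            (≤-trans (proj₂ (error-bounds N i))
              (subst ((½ ^ N * a N) * (3ℚ - 2ℚ * ½ ^ i) ≤_)
                (solve 1 (λ t → (t :* con 2ℚ) :* con 3ℚ := con 6ℚ :* t) refl (½ ^ N))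
                (*-mono-≤-nonNeg 0≤3-2½^ (*-nonNeg (0≤½^ N) (nonNegative⁻¹ 2ℚ))
                  (*-monoˡ-≤-nonNeg (½ ^ N) {{nonNegative (0≤½^ N)}} (proj₂ (αProduct-bounds N)))
                  (p-q≤p (*-nonNeg (nonNegative⁻¹ 2ℚ) (0≤½^ i)))))))))
      where
      z : ℚ
      z = ½ ^ suc i
      0≤F-1 : 0ℚ ≤ F N z - 1ℚ
      0≤F-1 = p≤q⇒0≤q-p (1≤F z (0≤½^ (suc i)) (½^[1+i]≤½ i) N)
      F-1≤ : F N z - 1ℚ ≤ (4ℚ * z) * 1ℚ
      F-1≤ = ≤-trans
        (p-q≤r {F N z} {1ℚ} (subst (F N z ≤_) (+-comm 1ℚ ((4ℚ * z) * (1ℚ - ½ ^ N))) (F≤ z (0≤½^ (suc i)) (½^[1+i]≤½ i) N)))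
        (*-monoˡ-≤-nonNeg (4ℚ * z) {{nonNegative (*-nonNeg (nonNegative⁻¹ 4ℚ) (0≤½^ (suc i)))}}
          (p-q≤p (0≤½^ N)))
      0≤3-2½^ : 0ℚ ≤ 3ℚ - 2ℚ * ½ ^ i
      0≤3-2½^ = p≤q⇒0≤q-p (≤-trans (*-monoˡ-≤-nonNeg 2ℚ (½^≤1 i)) (p≤p+q {2ℚ} {1ℚ} (<⇒≤ 0<1)))

    -- The value at -1 and the two parity classes.

    ∣^∣ : ∀ z N → ∣ z ^ N ∣ ≡ ∣ z ∣ ^ N
    ∣^∣ z zero    = refl
    ∣^∣ z (suc N) = trans (∣p*q∣≡∣p∣*∣q∣ z (z ^ N)) (cong (∣ z ∣ *_) (∣^∣ z N))

    -- The factor 1 + z vanishes at -1, so only the truncation term survives.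
    F[-1] : ∀ N → F N (- 1ℚ) ≡ (- ½) ^ N * a N
    F[-1] N = trans
      (solve 2 (λ f d → f := (f :+ con (- 1ℚ) :* d) :+ d) refl (F N (- 1ℚ)) ((- ½) ^ N * a N))
      (trans (cong (_+ (- ½) ^ N * a N) (trans (F-functional N (- 1ℚ)) (*-zeroˡ (F N (- ½)))))
        (+-identityˡ _))

    alternating-bound : ∀ N i → ∣ P i * F N (- 1ℚ) ∣ ≤ 2ℚ * ½ ^ N
    alternating-bound N i = subst₂ _≤_ (sym eq) (trans (*-identityˡ _) (*-comm (½ ^ N) 2ℚ))
      (*-mono-≤-nonNeg (*-nonNeg (0≤½^ N) (0≤a N)) (<⇒≤ 0<1) (proj₂ (eulerProduct-bounds i))
        (*-monoˡ-≤-nonNeg (½ ^ N) {{nonNegative (0≤½^ N)}} (proj₂ (αProduct-bounds N))))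
      where
      eq : ∣ P i * F N (- 1ℚ) ∣ ≡ P i * (½ ^ N * a N)
      eq = trans (∣p*q∣≡∣p∣*∣q∣ (P i) (F N (- 1ℚ)))
        (cong₂ _*_ (0≤p⇒∣p∣≡p (proj₁ (eulerProduct-bounds i)))
          (trans (cong ∣_∣ (F[-1] N)) (trans (∣p*q∣≡∣p∣*∣q∣ ((- ½) ^ N) (a N))
            (cong₂ _*_ (∣^∣ (- ½) N) (0≤p⇒∣p∣≡p (0≤a N))))))

    K≤1+double : ∀ K → K ℕ.≤ suc (double K)
    K≤1+double zero    = ℕ.z≤n
    K≤1+double (suc K) = ℕ.s≤s (ℕP.m≤n⇒m≤1+n (K≤1+double K))

    -- Shared by the half-sum and the half-difference. The bounds give 2 ½^i + 4 ½^N with N = 2K +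
    -- 1; this is weakened to a common factor 4, using K ≤ N.
    half-bound : ∀ K i u → ∣ u ∣ ≤ ∣ P i * F (suc (double K)) 1ℚ - 2ℚ ∣ + ∣ P i * F (suc (double K)) (- 1ℚ) ∣ →
      ∣ ½ * u ∣ ≤ 4ℚ * (½ ^ i + ½ ^ K)
    half-bound K i u h = ≤-trans
      (subst₂ _≤_ (sym (∣p*q∣≡∣p∣*∣q∣ ½ u))
        (solve 2 (λ s t → con ½ :* ((con 4ℚ :* s :+ con 6ℚ :* t) :+ con 2ℚ :* t) := con 2ℚ :* s :+ con 4ℚ :* t)
          refl (½ ^ i) (½ ^ N))
        (*-monoˡ-≤-nonNeg ½ (≤-trans h (+-mono-≤ (total-bound N i) (alternating-bound N i)))))
      (subst (2ℚ * ½ ^ i + 4ℚ * ½ ^ N ≤_) (sym (*-distribˡ-+ 4ℚ (½ ^ i) (½ ^ K)))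
        (+-mono-≤ (*-monoʳ-≤-nonNeg (½ ^ i) {{nonNegative (0≤½^ i)}} (p≤p+q {2ℚ} {2ℚ} (nonNegative⁻¹ 2ℚ)))
          (*-monoˡ-≤-nonNeg 4ℚ (½^-anti (K≤1+double K)))))
      where
      N : ℕ
      N = suc (double K)

    evenSum-limit : ∀ K i → ∣ P i * evenSum (suc K) - 1ℚ ∣ ≤ 4ℚ * (½ ^ i + ½ ^ K)
    evenSum-limit K i = subst (λ x → ∣ x ∣ ≤ 4ℚ * (½ ^ i + ½ ^ K))
      (trans
        (cong₂ (λ x y → ½ * ((P i * x - 2ℚ) + P i * y)) (F-parity 1ℚ refl K) (F-parity (- 1ℚ) refl K))
        (solve 3 (λ p e o → con ½ :* ((p :* (e :+ con 1ℚ :* o) :- con 2ℚ) :+ p :* (e :+ con (- 1ℚ) :* o))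
          := p :* e :- con 1ℚ) refl (P i) (evenSum (suc K)) (oddSum (suc K))))
      (half-bound K i _ (∣p+q∣≤∣p∣+∣q∣ (P i * F (suc (double K)) 1ℚ - 2ℚ) _))

    oddSum-limit : ∀ K i → ∣ P i * oddSum (suc K) - 1ℚ ∣ ≤ 4ℚ * (½ ^ i + ½ ^ K)
    oddSum-limit K i = subst (λ x → ∣ x ∣ ≤ 4ℚ * (½ ^ i + ½ ^ K))
      (trans
        (cong₂ (λ x y → ½ * ((P i * x - 2ℚ) - P i * y)) (F-parity 1ℚ refl K) (F-parity (- 1ℚ) refl K))
        (solve 3 (λ p e o → con ½ :* ((p :* (e :+ con 1ℚ :* o) :- con 2ℚ) :- p :* (e :+ con (- 1ℚ) :* o))
          := p :* o :- con 1ℚ) refl (P i) (evenSum (suc K)) (oddSum (suc K))))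
      (half-bound K i _ (∣p-q∣≤∣p∣+∣q∣ (P i * F (suc (double K)) 1ℚ - 2ℚ) _))

    -- Combining the partial sums of consecutive β series.

    2^-homo-+ : ∀ k l → 2ℚ ^ (k ℕ.+ l) ≡ 2ℚ ^ k * 2ℚ ^ l
    2^-homo-+ zero    l = sym (*-identityˡ (2ℚ ^ l))
    2^-homo-+ (suc k) l = trans (cong (2ℚ *_) (2^-homo-+ k l)) (sym (*-assoc 2ℚ (2ℚ ^ k) (2ℚ ^ l)))

    -- Once 2 a_k is replaced by (2^(k+1) - 1) a_(k+1), the numerators add up to 2^n (2^(k+1) - 1) +
    -- 2^n - 1 = 2^(n+k+1) - 1, which cancels the denominator.
    term-identity : ∀ n k p → let v = 1/[2^ suc (n ℕ.+ k) -1] in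
      2ℚ ^ suc n * ((p * a k) * v) + (2ℚ ^ n - 1ℚ) * ((p * a (suc k)) * v) ≡ p * a (suc k)
    term-identity n k p = trans
      (solve 5 (λ x p b c v → (con 2ℚ :* x) :* ((p :* b) :* v) :+ (x :- con 1ℚ) :* ((p :* c) :* v)
         := x :* (p :* v) :* (con 2ℚ :* b) :+ (x :- con 1ℚ) :* ((p :* c) :* v)) refl x p (a k) c v)
      (trans (cong (λ t → x * (p * v) * t + (x - 1ℚ) * ((p * c) * v)) (sym (a-recurrence k)))
      (trans (solve 5 (λ x y p c v →
                x :* (p :* v) :* ((con 2ℚ :* y :- con 1ℚ) :* c) :+ (x :- con 1ℚ) :* ((p :* c) :* v)
                := (p :* c) :* ((con 2ℚ :* (x :* y) :- con 1ℚ) :* v)) refl x (2ℚ ^ k) p c v)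
      (trans (cong (λ t → (p * c) * ((2ℚ * t - 1ℚ) * v)) (sym (2^-homo-+ n k)))
      (trans (cong ((p * c) *_) (2^k-1-inverse (suc (n ℕ.+ k))))
        (*-identityʳ (p * c))))))
      where
      x c v : ℚ
      x = 2ℚ ^ n
      c = a (suc k)
      v = 1/[2^ suc (n ℕ.+ k) -1]

    sum-step : ∀ x y p {s s′ o t t′ c} → x * s + y * s′ ≡ p * o → x * t + y * t′ ≡ p * c →
      x * (s + t) + y * (s′ + t′) ≡ p * (o + c)
    sum-step x y p {s} {s′} {o} {t} {t′} {c} h k = trans
      (solve 6 (λ x y s s′ t t′ → x :* (s :+ t) :+ y :* (s′ :+ t′)
         := (x :* s :+ y :* s′) :+ (x :* t :+ y :* t′)) refl x y s s′ t t′)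
      (trans (cong₂ _+_ h k) (sym (*-distribˡ-+ p o c)))

    double≡2* : ∀ r → double r ≡ 2 ℕ.* r
    double≡2* zero    = refl
    double≡2* (suc r) = trans (cong (2 ℕ.+_) (double≡2* r)) (sym (ℕP.*-suc 2 r))

    -- The free `μ` and `e` let terms of two consecutive series be written with literally the same
    -- exponent, as `term-identity` requires.
    βTerm-seq : ∀ n r i {μ e} .{{_ : ℕ.NonZero e}} → m n ≡ μ → n ℕ.+ (μ ℕ.+ double r) ≡ e →
      seq (βTerm n r) i ≡ (P i * a (μ ℕ.+ double r)) * 1/[2^ e -1]
    βTerm-seq n r i {μ} {e} hμ he = reindex {{exponent≢0 n r}} index
      (trans (ℕP.+-assoc n (2 ℕ.* r) (m n)) (trans (cong (n ℕ.+_) index) he))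
      where
      index : 2 ℕ.* r ℕ.+ m n ≡ μ ℕ.+ double r
      index = trans (ℕP.+-comm (2 ℕ.* r) (m n)) (cong₂ ℕ._+_ hμ (sym (double≡2* r)))
      reindex : ∀ {k k′ f f′} .{{_ : ℕ.NonZero f}} .{{_ : ℕ.NonZero f′}} → k ≡ k′ → f ≡ f′ →
        (P i * a k) * 1/[2^ f -1] ≡ (P i * a k′) * 1/[2^ f′ -1]
      reindex refl refl = refl

    m-cases : ∀ n → (m n ≡ 1 × m (suc n) ≡ 0) ⊎ (m n ≡ 0 × m (suc n) ≡ 1)
    m-cases zero          = inj₁ (refl , refl)
    m-cases (suc zero)    = inj₂ (refl , refl)
    -- The remainder modulo 2 is unchanged, by computation, when two successors are removed.
    m-cases (suc (suc n)) = m-cases n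

  βPartial : ℕ → ℕ → ℕ → ℚ
  βPartial n K i = seq (∑ (βTerm n) K) i

  -- The cutoffs differ because, for even n + 1, the exponent of the r-th term of β (n + 1) is that of
  -- the (r + 1)-st term of β n.
  recurrenceLHS : ℕ → ℕ → ℕ → ℕ → ℚ
  recurrenceLHS n L L′ i = 2ℚ ^ suc n * βPartial (suc n) L i + (2ℚ ^ n - 1ℚ) * βPartial n L′ i

  abstract
    oddSum-identity : ∀ n → m n ≡ 1 → m (suc n) ≡ 0 → ∀ K i →
      recurrenceLHS n K K i ≡ P i * oddSum K
    oddSum-identity n h h′ zero i = solve 3 (λ x y p → x :* con 0ℚ :+ y :* con 0ℚ := p :* con 0ℚ) refl
      (2ℚ ^ suc n) (2ℚ ^ n - 1ℚ) (P i)
    oddSum-identity n h h′ (suc K) i = sum-step (2ℚ ^ suc n) (2ℚ ^ n - 1ℚ) (P i)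
      (oddSum-identity n h h′ K i)
      (trans
        (cong₂ (λ t t′ → 2ℚ ^ suc n * t + (2ℚ ^ n - 1ℚ) * t′)
          (βTerm-seq (suc n) K i h′ refl)
          (βTerm-seq n K i h (ℕP.+-suc n (double K))))
        (term-identity n (double K) (P i)))

    evenSum-identity : ∀ n → m n ≡ 0 → m (suc n) ≡ 1 → ∀ K i →
      recurrenceLHS n K (suc K) i ≡ P i * evenSum (suc K)
    -- The unpaired term r = 0 of the series with the smaller index: its denominator cancels and
    -- leaves a_0 = 1. Index 0 is excluded by `h`, since `m 0` is 1.
    evenSum-identity (suc n) h h′ zero i = trans
      (cong (λ t → 2ℚ ^ suc (suc n) * 0ℚ + (2ℚ ^ suc n - 1ℚ) * (0ℚ + t))
        (βTerm-seq (suc n) 0 i h (ℕP.+-identityʳ (suc n))))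
      (trans
        (solve 4 (λ x y p v → x :* con 0ℚ :+ y :* (con 0ℚ :+ (p :* con 1ℚ) :* v) := p :* (y :* v)) refl
          (2ℚ ^ suc (suc n)) (2ℚ ^ suc n - 1ℚ) (P i) 1/[2^ suc n -1])
        (cong (P i *_) (2^k-1-inverse (suc n))))
    evenSum-identity n h h′ (suc K) i = sum-step (2ℚ ^ suc n) (2ℚ ^ n - 1ℚ) (P i)
      (evenSum-identity n h h′ K i)
      (trans
        (cong₂ (λ t t′ → 2ℚ ^ suc n * t + (2ℚ ^ n - 1ℚ) * t′)
          (βTerm-seq (suc n) K i h′ refl)
          (βTerm-seq n (suc K) i h (ℕP.+-suc n (suc (double K)))))
        (term-identity n (suc (double K)) (P i)))

    -- Existential cutoffs hide the parity of n from the limit argument.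
    recurrenceLHS-limit : ∀ n K → ∃[ L ] ∃[ L′ ] (K ℕ.≤ L) × (K ℕ.≤ L′) ×
      (∀ i → ∣ recurrenceLHS n L L′ i - 1ℚ ∣ ≤ 4ℚ * (½ ^ i + ½ ^ K))
    recurrenceLHS-limit n K with m-cases n
    ... | inj₁ (h , h′) = suc K , suc K , ℕP.n≤1+n K , ℕP.n≤1+n K , λ i →
      subst (λ x → ∣ x - 1ℚ ∣ ≤ 4ℚ * (½ ^ i + ½ ^ K)) (sym (oddSum-identity n h h′ (suc K) i)) (oddSum-limit K i)
    ... | inj₂ (h , h′) = K , suc K , ℕP.≤-refl , ℕP.n≤1+n K , λ i →
      subst (λ x → ∣ x - 1ℚ ∣ ≤ 4ℚ * (½ ^ i + ½ ^ K)) (sym (evenSum-identity n h h′ K i)) (evenSum-limit K i)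

    -- Passage to the limit.

    -- `I` depends on n: a partial sum has to be fixed before the approximation index grows.
    ⟶-pointwise : ∀ s x → s ⟶ x → ∀ ε → 0ℚ < ε →
      ∃[ N ] ∀ n → N ℕ.≤ n → ∃[ I ] ∀ i → I ℕ.≤ i → ∣ seq (s n) i - seq x i ∣ < ε
    ⟶-pointwise s x conv ε 0<ε with conv ε 0<ε
    ... | N , h = N , λ n N≤n → pointwise Real.∣ s n Real.- x ∣ (h n N≤n)
      where
      pointwise : ∀ y → y Real.< ι ε → ∃[ I ] ∀ i → I ℕ.≤ i → seq y i < ε
      pointwise _ (δ , 0<δ , I , g) = I , λ i I≤i → p+δ≤q⇒p<q 0<δ (g i I≤i)

    scale-≤ : ∀ {c} → 0ℚ ≤ c → c ≤ 1ℚ → ∀ x → ∣ c * x ∣ ≤ ∣ x ∣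
    scale-≤ {c} 0≤c c≤1 x = subst₂ _≤_
      (trans (cong (_* ∣ x ∣) (sym (0≤p⇒∣p∣≡p 0≤c))) (sym (∣p*q∣≡∣p∣*∣q∣ c x))) (*-identityˡ ∣ x ∣)
      (*-monoʳ-≤-nonNeg ∣ x ∣ {{nonNegative (0≤∣p∣ x)}} c≤1)

    -- With h = ½^(n+1) and X the middle difference, 2^(n+1) h = 1 makes the left side the absolute
    -- value of -(B - b) + h X - h c (B′ - b′). Both h and h c lie in [0, 1], so no constant depends
    -- on n.
    recurrence-error : ∀ n b b′ B B′ → let c = 2ℚ ^ n - 1ℚ in
      ∣ b - ½ ^ suc n * (1ℚ - c * b′) ∣ ≤
      ∣ B - b ∣ + (∣ (2ℚ ^ suc n * B + c * B′) - 1ℚ ∣ + ∣ B′ - b′ ∣)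
    recurrence-error n b b′ B B′ = subst (λ x → ∣ x ∣ ≤ ∣ B - b ∣ + (∣ X ∣ + ∣ B′ - b′ ∣)) eq
      (≤-trans (∣p+q∣≤∣p∣+∣q∣ (- (B - b)) (h * X - (h * c) * (B′ - b′)))
        (+-mono-≤ (≤-reflexive (∣-p∣≡∣p∣ (B - b)))
          (≤-trans (∣p-q∣≤∣p∣+∣q∣ (h * X) ((h * c) * (B′ - b′)))
            (+-mono-≤ (scale-≤ (0≤½^ (suc n)) (½^≤1 (suc n)) X)
              (scale-≤ (*-nonNeg (0≤½^ (suc n)) (p≤q⇒0≤q-p (1≤2^ n))) hc≤1 (B′ - b′))))))
      where
      c h X : ℚ
      c = 2ℚ ^ n - 1ℚ
      h = ½ ^ suc n
      X = (2ℚ ^ suc n * B + c * B′) - 1ℚ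
      eq : - (B - b) + (h * X - (h * c) * (B′ - b′)) ≡ b - h * (1ℚ - c * b′)
      eq = trans
        (solve 7 (λ b b′ B B′ c h g →
            :- (B :- b) :+ (h :* ((g :* B :+ c :* B′) :- con 1ℚ) :- (h :* c) :* (B′ :- b′))
            := (b :- h :* (con 1ℚ :- c :* b′)) :+ B :* (g :* h :- con 1ℚ)) refl
          b b′ B B′ c h (2ℚ ^ suc n))
        (trans (cong (λ t → (b - h * (1ℚ - c * b′)) + B * (t - 1ℚ)) (2^*½^ (suc n)))
          (solve 2 (λ x B → x :+ B :* con 0ℚ := x) refl (b - h * (1ℚ - c * b′)) B))
      hc≤1 : h * c ≤ 1ℚ
      hc≤1 = subst (h * c ≤_) (trans (*-comm (½ ^ n) (2ℚ ^ n)) (2^*½^ n))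
        (*-mono-≤-nonNeg (p≤q⇒0≤q-p (1≤2^ n)) (0≤½^ n) (½^-step n) (p-q≤p {2ℚ ^ n} (<⇒≤ 0<1)))

    limit-recurrence : ∀ n b b′ → ∑ (βTerm (suc n)) ⟶ b → ∑ (βTerm n) ⟶ b′ →
      b ≃ ι (½ ^ suc n) Real.* (ι 1ℚ Real.- ι (2ℚ ^ n - 1ℚ) Real.* b′)
    limit-recurrence n b b′ conv conv′ ε 0<ε
      -- The three errors get ε/2, ε/4 and ε/4. The constant 8 arises as 4 (½^i + ½^K) ≤ 8 ½^M for
      -- i, K ≥ M.
      with ⟶-pointwise (∑ (βTerm (suc n))) b conv (½ * ε) (½-pos 0<ε)
         | ⟶-pointwise (∑ (βTerm n)) b′ conv′ (½ * (½ * ε)) (½-pos (½-pos 0<ε))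
         | ½^-small 8ℚ (½-pos (½-pos 0<ε))
    -- One K above all three thresholds fixes both cutoffs; only then are `I` and `I′` chosen.
    ... | N , near | N′ , near′ | M , small with recurrenceLHS-limit n (N ℕ.⊔ (N′ ℕ.⊔ M))
    ... | L , L′ , K≤L , K≤L′ , lhs
      with near L (ℕP.≤-trans (ℕP.m≤m⊔n N (N′ ℕ.⊔ M)) K≤L)
         | near′ L′ (ℕP.≤-trans (ℕP.≤-trans (ℕP.m≤m⊔n N′ M) (ℕP.m≤n⊔m N (N′ ℕ.⊔ M))) K≤L′)
    ... | I , close | I′ , close′ = I ℕ.⊔ (I′ ℕ.⊔ M) , λ i h → ≤-<-trans
      (recurrence-error n (seq b i) (seq b′ i) (βPartial (suc n) L i) (βPartial n L′ i))
      (split-< (∣ βPartial (suc n) L i - seq b i ∣)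
        (∣ recurrenceLHS n L L′ i - 1ℚ ∣ + ∣ βPartial n L′ i - seq b′ i ∣)
        (close i (ℕP.≤-trans (ℕP.m≤m⊔n I (I′ ℕ.⊔ M)) h))
        (split-< (∣ recurrenceLHS n L L′ i - 1ℚ ∣) (∣ βPartial n L′ i - seq b′ i ∣)
          (≤-<-trans (lhs i) (small-sum i (ℕP.≤-trans (ℕP.≤-trans (ℕP.m≤n⊔m I′ M) (ℕP.m≤n⊔m I (I′ ℕ.⊔ M))) h)))
          (close′ i (ℕP.≤-trans (ℕP.≤-trans (ℕP.m≤m⊔n I′ M) (ℕP.m≤n⊔m I (I′ ℕ.⊔ M))) h))))
      where
      small-sum : ∀ i → M ℕ.≤ i → 4ℚ * (½ ^ i + ½ ^ (N ℕ.⊔ (N′ ℕ.⊔ M))) < ½ * (½ * ε)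
      small-sum i M≤i = ≤-<-trans
        (*-monoˡ-≤-nonNeg 4ℚ (+-mono-≤ (½^-anti M≤i)
          (½^-anti (ℕP.≤-trans (ℕP.m≤n⊔m N′ M) (ℕP.m≤n⊔m N (N′ ℕ.⊔ M))))))
        (subst (_< ½ * (½ * ε))
          (solve 1 (λ t → con 8ℚ :* t := con 4ℚ :* (t :+ t)) refl (½ ^ M)) small)

    recurrence : ∀ n → β (suc n) ≃ ι (½ ^ suc n) Real.* (ι 1ℚ Real.- ι (2ℚ ^ n - 1ℚ) Real.* β n)
    recurrence n = limit-recurrence n (β (suc n)) (β n)
      (lim-converges (∑ (βTerm (suc n))) (βSum-cauchy (suc n)))
      (lim-converges (∑ (βTerm n)) (βSum-cauchy n))

    ≃-respʳ-pointwise : ∀ x y z → (∀ i → seq y i ≡ seq z i) → x ≃ y → x ≃ z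
    ≃-respʳ-pointwise x y z y≡z x≃y ε 0<ε = proj₁ (x≃y ε 0<ε) , λ i N≤i →
      subst (λ q → ∣ seq x i - q ∣ < ε) (y≡z i) (proj₂ (x≃y ε 0<ε) i N≤i)

    -- The recurrence starting from `β 0`, whose coefficient 2^0 - 1 is zero.
    β₁ : β 1 ≃ ι ½
    β₁ = ≃-respʳ-pointwise (β 1) (ι (½ ^ 1) Real.* (ι 1ℚ Real.- ι (2ℚ ^ 0 - 1ℚ) Real.* β 0)) (ι ½)
      (λ i → cong (λ t → ½ * (1ℚ - t)) (*-zeroˡ (seq (β 0) i)))
      (recurrence 0)

open import Defs using (_*_; _-_)
open import Data.Nat.Base using (_∸_; _≤_)

proposition1p10 : (β 1 ≃ ι ½) ×
    (∀ (n : ℕ) → 2 ≤ n →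
    β n ≃ ι (½ ^ n) * (ι 1ℚ - ι (2ℚ ^ (n ∸ 1) ℚ.- 1ℚ) * β (n ∸ 1)))
proposition1p10 = β₁ , λ { (suc n) _ → recurrence n }
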